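{- Let $\mathcal{B}$ be a swap structure for $\mathbf{mbCci}$. Then there exist a set $I$ and a monomorphism of multialgebras $\hat h:\mathcal{B}\to\prod_{i\in I}\mathcal{B}_{\mathbb{A}_2}^{\mathbf{mbCci}}$.
   Context: Let $\Sigma=\{\wedge,\vee,\to,\neg,\circ\}$, with $\wedge,\vee,\to$ binary and $\neg,\circ$ unary. A multialgebra over $\Sigma$ is a nonempty set $B$ with, for each $n$-ary symbol $c$, a function $c^{\mathcal{B}}:B^n\to\wp(B)\setminus\{\emptyset\}$. A homomorphism $f:\mathcal{A}\to\mathcal{B}$ is a function between the domains with $f[c^{\mathcal{A}}(\vec a)]\subseteq c^{\mathcal{B}}(f(\vec a))$ for all $c$ and $\vec a$. These form the category $\mathbf{MAlg}(\Sigma)$; a monomorphism of multialgebras is a monomorphism in this category. The product $\prod_{i\in I}\mathcal{A}_i$ has as domain the cartesian product of the domains and multioperations $c(\vec a)=\prod_{i\in I}c^{\mathcal{A}_i}(\pi_i(\vec a))$ (for $I=\emptyset$ it is the one-element multialgebra). For a Boolean algebra $\mathcal{A}$ with domain $A$ (the one-element Boolean algebra is allowed) and $z\in A^3$ write $z=(z_1,z_2,z_3)$; $\sim$ is Boolean complement. Put $\mathrm{B}_{\mathcal{A}}^{\mathbf{ciw}}=\{z\in A^3 : z_1\vee z_2=1 \text{ and } z_3={\sim}(z_1\wedge z_2)\}$. A swap structure for $\mathbf{mbCci}$ over $\mathcal{A}$ is a multialgebra $\mathcal{B}$ over $\Sigma$ with domain $B\subseteq \mathrm{B}_{\mathcal{A}}^{\mathbf{ciw}}$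 such that $0\in\{z_1: z\in B\}$ and for all $z,w\in B$: (i) $\emptyset\ne z\#w\subseteq\{u\in B: u_1=z_1\# w_1\}$ for $\#\in\{\wedge,\vee,\to\}$; (ii) $\emptyset\neq\neg z\subseteq\{u\in B:u_1=z_2\}$; (iii) $\circ z=\{({\sim}(z_1\wedge z_2),z_1\wedge z_2,1)\}$. A swap structure for $\mathbf{mbCci}$ is one over some Boolean algebra. The full swap structure $\mathcal{B}_{\mathcal{A}}^{\mathbf{mbCci}}$ has domain $\mathrm{B}_{\mathcal{A}}^{\mathbf{ciw}}$ and equality in the right-hand inclusions of (i)–(ii), with (iii) unchanged. $\mathbb{A}_2$ is the two-element Boolean algebra. -}

module Defs where

open import Algebra.Lattice.Bundles using (BooleanAlgebra)
import Algebra.Lattice.Properties.BooleanAlgebra as BooleanAlgebraProperties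
open import Data.Bool.Properties using (∨-∧-booleanAlgebra)
open import Data.Nat.Base using (ℕ)
open import Data.Product.Base using (Σ; Σ-syntax; ∃; _×_; _,_; proj₁; proj₂)
open import Data.Product.Relation.Binary.Pointwise.NonDependent using (×-setoid)
open import Data.Vec.Base using (Vec; []; _∷_; map)
open import Data.Vec.Relation.Binary.Pointwise.Inductive using (Pointwise; []; _∷_)
import Data.Vec.Relation.Binary.Pointwise.Inductive as Pointwise
open import Function.Base using (id)
open import Function.Bundles using (Func; _⇔_; mk⇔)
open import Level using (Level; suc; _⊔_; 0ℓ)
open import Relation.Binary.Bundles using (Setoid)
import Relation.Binary.Construct.On as On

private
  variable
    a b i ℓ : Level

-- Zermelo's axiom of choice, in its setoid form: the chosen f has to respect
-- the equality of X.  (Without that requirement the statement would be the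
-- trivial "type-theoretic axiom of choice".)  By Diaconescu's argument it
-- implies excluded middle for Set ℓ, so assuming it amounts to working in
-- classical mathematics with choice.

AxiomOfChoice : ∀ ℓ → Set (suc ℓ)
AxiomOfChoice ℓ =
  (X Y : Setoid ℓ ℓ) (let module X = Setoid X; module Y = Setoid Y)
  (R : X.Carrier → Y.Carrier → Set ℓ) →
  (∀ {x x′ y y′} → x X.≈ x′ → y Y.≈ y′ → R x y → R x′ y′) →
  (∀ x → ∃ λ y → R x y) →
  Σ[ f ∈ Func X Y ] (∀ x → R x (Func.to f x))

data Symbol : ℕ → Set where
  ∧′ ∨′ →′ : Symbol 2
  ¬′ ∘′    : Symbol 1

-- Sets are setoids, as for the algebraic structures of the library.
-- `op c as u` reads: u is an element of the value c(as).

record Multioperations (S : Setoid ℓ ℓ) : Set (suc ℓ) where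
  open Setoid S
  field
    op          : ∀ {n} → Symbol n → Vec Carrier n → Carrier → Set ℓ
    op-resp     : ∀ {n} (c : Symbol n) {as bs u v} →
                  Pointwise _≈_ as bs → u ≈ v → op c as u → op c bs v
    op-nonempty : ∀ {n} (c : Symbol n) as → ∃ λ u → op c as u

record Multialgebra ℓ : Set (suc ℓ) where
  field
    domain          : Setoid ℓ ℓ
    nonempty        : Setoid.Carrier domain
    multioperations : Multioperations domain

  open Setoid domain public
  open Multioperations multioperations public

record Hom (𝓐 : Multialgebra a) (𝓑 : Multialgebra b) : Set (a ⊔ b) where
  private
    module A = Multialgebra 𝓐
    module B = Multialgebra 𝓑
  field
    to   : A.Carrier → B.Carrier
    cong : ∀ {x y} → x A.≈ y → to x B.≈ to y
    hom  : ∀ {n} (c : Symbol n) {as u} → A.op c as u → B.op c (map to as) (to u)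

-- Left cancellability, in the category of the multialgebras of level ℓ.

IsMonomorphism : {𝓐 𝓑 : Multialgebra ℓ} → Hom 𝓐 𝓑 → Set (suc ℓ)
IsMonomorphism {ℓ} {𝓐} {𝓑} f =
  (𝓒 : Multialgebra ℓ) (g h : Hom 𝓒 𝓐) →
  (∀ x → to f (to g x) B.≈ to f (to h x)) →
  (∀ x → to g x A.≈ to h x)
  where
  open Hom
  module A = Multialgebra 𝓐
  module B = Multialgebra 𝓑

∏ : (I : Set i) → (I → Multialgebra ℓ) → Multialgebra (i ⊔ ℓ)
∏ I 𝓐 = record
  { domain = record
    { Carrier       = ∀ j → A.Carrier j
    ; _≈_           = λ x y → ∀ j → A._≈_ j (x j) (y j)
    ; isEquivalence = record
      { refl  = λ j → A.refl j
      ; sym   = λ p j → A.sym j (p j)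
      ; trans = λ p q j → A.trans j (p j) (q j)
      }
    }
  ; nonempty        = λ j → A.nonempty j
  ; multioperations = record
    { op          = λ c as u → ∀ j → A.op j c (map (λ x → x j) as) (u j)
    ; op-resp     = λ c ps q r j →
                    A.op-resp j c (Pointwise.map⁺ (λ p → p j) ps) (q j) (r j)
    ; op-nonempty = λ c as →
                    (λ j → proj₁ (A.op-nonempty j c (map (λ x → x j) as))) ,
                    (λ j → proj₂ (A.op-nonempty j c (map (λ x → x j) as)))
    }
  }
  where module A (j : I) = Multialgebra (𝓐 j)

module Snapshots (𝓐 : BooleanAlgebra ℓ ℓ) where
  open BooleanAlgebra 𝓐

  tripleSetoid : Setoid ℓ ℓ
  tripleSetoid = ×-setoid setoid (×-setoid setoid setoid)

  open Setoid tripleSetoid public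
    using () renaming (Carrier to Triple; _≈_ to _≈₃_)

  infix 9 _₁ _₂ _₃
  _₁ _₂ _₃ : Triple → Carrier
  (x , _ , _) ₁ = x
  (_ , y , _) ₂ = y
  (_ , _ , z) ₃ = z

  infixr 5 _⇒_
  _⇒_ : Carrier → Carrier → Carrier
  x ⇒ y = ¬ x ∨ y

  InBciw : Triple → Set ℓ
  InBciw z = (z ₁ ∨ z ₂ ≈ ⊤) × (z ₃ ≈ ¬ (z ₁ ∧ z ₂))

  ∘-value : Triple → Triple
  ∘-value z = ¬ (z ₁ ∧ z ₂) , z ₁ ∧ z ₂ , ⊤

  subsetoid : (Triple → Set ℓ) → Setoid ℓ ℓ
  subsetoid Dom = On.setoid tripleSetoid (proj₁ {B = Dom})

record SwapStructure (𝓐 : BooleanAlgebra ℓ ℓ) : Set (suc ℓ) where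
  open BooleanAlgebra 𝓐
  open Snapshots 𝓐
  field
    Dom             : Triple → Set ℓ
    Dom-resp        : ∀ {z w} → z ≈₃ w → Dom z → Dom w
    Dom⊆Bciw        : ∀ {z} → Dom z → InBciw z
    0∈π₁[Dom]       : ∃ λ z → Dom z × z ₁ ≈ ⊥
    multioperations : Multioperations (subsetoid Dom)

  B : Set ℓ
  B = Σ Triple Dom

  open Multioperations multioperations public

  field
    ∧-swap : ∀ (z w u : B) → op ∧′ (z ∷ w ∷ []) u → proj₁ u ₁ ≈ proj₁ z ₁ ∧ proj₁ w ₁
    ∨-swap : ∀ (z w u : B) → op ∨′ (z ∷ w ∷ []) u → proj₁ u ₁ ≈ proj₁ z ₁ ∨ proj₁ w ₁
    →-swap : ∀ (z w u : B) → op →′ (z ∷ w ∷ []) u → proj₁ u ₁ ≈ (proj₁ z ₁ ⇒ proj₁ w ₁)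
    ¬-swap : ∀ (z u : B) → op ¬′ (z ∷ []) u → proj₁ u ₁ ≈ proj₁ z ₂
    ∘-swap : ∀ (z u : B) → op ∘′ (z ∷ []) u ⇔ proj₁ u ≈₃ ∘-value (proj₁ z)

  multialgebra : Multialgebra ℓ
  multialgebra = record
    { domain          = subsetoid Dom
    ; nonempty        = proj₁ 0∈π₁[Dom] , proj₁ (proj₂ 0∈π₁[Dom])
    ; multioperations = multioperations
    }

fullSwap : (𝓐 : BooleanAlgebra ℓ ℓ) → SwapStructure 𝓐
fullSwap {ℓ} 𝓐 = record
  { Dom             = InBciw
  ; Dom-resp        = λ { (p₁ , p₂ , p₃) (q , r) →
                        trans (sym (∨-cong p₁ p₂)) q ,
                        trans (sym p₃) (trans r (¬-cong (∧-cong p₁ p₂))) }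
  ; Dom⊆Bciw        = id
  ; 0∈π₁[Dom]       = proj₁ (classical ⊥) , proj₂ (classical ⊥) , refl
  ; multioperations = record
    { op          = op
    ; op-resp     = op-resp
    ; op-nonempty = op-nonempty
    }
  ; ∧-swap = λ _ _ _ p → p
  ; ∨-swap = λ _ _ _ p → p
  ; →-swap = λ _ _ _ p → p
  ; ¬-swap = λ _ _ p → p
  ; ∘-swap = λ _ _ → mk⇔ id id
  }
  where
  open BooleanAlgebra 𝓐
  open BooleanAlgebraProperties 𝓐 using (¬⊥≈⊤)
  open Snapshots 𝓐
  module S = Setoid tripleSetoid

  B : Set ℓ
  B = Σ Triple InBciw

  op : ∀ {n} → Symbol n → Vec B n → B → Set ℓ
  op ∧′ ((z , _) ∷ (w , _) ∷ []) (u , _) = u ₁ ≈ z ₁ ∧ w ₁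
  op ∨′ ((z , _) ∷ (w , _) ∷ []) (u , _) = u ₁ ≈ z ₁ ∨ w ₁
  op →′ ((z , _) ∷ (w , _) ∷ []) (u , _) = u ₁ ≈ (z ₁ ⇒ w ₁)
  op ¬′ ((z , _) ∷ [])           (u , _) = u ₁ ≈ z ₂
  op ∘′ ((z , _) ∷ [])           (u , _) = u ≈₃ ∘-value z

  classical : Carrier → B
  classical x = (x , ¬ x , ⊤) ,
    ∨-complementʳ x , sym (trans (¬-cong (∧-complementʳ x)) ¬⊥≈⊤)

  op-resp : ∀ {n} (c : Symbol n) {as bs u v} →
            Pointwise (λ x y → proj₁ x ≈₃ proj₁ y) as bs →
            proj₁ u ≈₃ proj₁ v → op c as u → op c bs v
  op-resp ∧′ ((p , _) ∷ (q , _) ∷ []) (r , _) s = trans (sym r) (trans s (∧-cong p q))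
  op-resp ∨′ ((p , _) ∷ (q , _) ∷ []) (r , _) s = trans (sym r) (trans s (∨-cong p q))
  op-resp →′ ((p , _) ∷ (q , _) ∷ []) (r , _) s =
    trans (sym r) (trans s (∨-cong (¬-cong p) q))
  op-resp ¬′ ((_ , p , _) ∷ []) (r , _) s = trans (sym r) (trans s p)
  op-resp ∘′ ((p , q , _) ∷ []) r s =
    S.trans (S.sym r) (S.trans s (¬-cong (∧-cong p q) , ∧-cong p q , refl))

  op-nonempty : ∀ {n} (c : Symbol n) as → ∃ λ u → op c as u
  op-nonempty ∧′ ((z , _) ∷ (w , _) ∷ []) = classical (z ₁ ∧ w ₁) , refl
  op-nonempty ∨′ ((z , _) ∷ (w , _) ∷ []) = classical (z ₁ ∨ w ₁) , refl
  op-nonempty →′ ((z , _) ∷ (w , _) ∷ []) = classical (z ₁ ⇒ w ₁) , refl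
  op-nonempty ¬′ ((z , _) ∷ [])           = classical (z ₂) , refl
  op-nonempty ∘′ ((z , _) ∷ [])           =
    (∘-value z ,
     trans (∨-comm _ _) (∨-complementʳ _) ,
     sym (trans (¬-cong (trans (∧-comm _ _) (∧-complementʳ _))) ¬⊥≈⊤)) ,
    S.refl

𝔸₂ : BooleanAlgebra 0ℓ 0ℓ
𝔸₂ = ∨-∧-booleanAlgebra

{-# OPTIONS --safe #-}

-- The coordinates z₁ and z₂ determine a snapshot z, and every Boolean
-- homomorphism χ : 𝓐 → 𝔸₂ acts on snapshots coordinatewise.  So the family of
-- all χ gives a homomorphism of multialgebras into the power of the full swap
-- structure over 𝔸₂, and it is injective because the χ separate points of 𝓐.
--
-- Separation of points is the Boolean prime ideal theorem.  Choice yields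
-- excluded middle, so subsets can be taken Bool-valued, which keeps the
-- powerset in Set ℓ.  A proper filter S with chosen undecided element a is
-- enlarged to {x | a ⇒ x ∈ S}; iterating this transfinitely and taking unions
-- of chains ends in an ultrafilter.

module Submission where

open import Defs
open import Algebra.Lattice.Bundles using (BooleanAlgebra)
import Algebra.Lattice.Properties.BooleanAlgebra as BooleanAlgebraProperties
open import Axiom.ExcludedMiddle using (ExcludedMiddle)
open import Data.Bool.Base as Bool using (Bool; true; false; T)
open import Data.Bool.Properties as Bool using (T-∨; T-≡; ⇔→≡)
open import Data.Empty using (⊥-elim)
open import Data.Product.Base using (Σ-syntax; ∃; _×_; _,_; proj₁; proj₂)
open import Data.Sum.Base using (_⊎_; inj₁; inj₂; [_,_]; map₂)
open import Data.Unit.Base using (tt)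
open import Data.Vec.Base using ([]; _∷_; map)
open import Function.Base using (_∘_; id; case_of_)
open import Function.Bundles using (Func; Equivalence; mk⇔)
open import Level using (Level; Lift; lift; lower)
open import Relation.Binary.Bundles using (Setoid)
open import Relation.Binary.PropositionalEquality as ≡ using (_≡_)
import Relation.Binary.Reasoning.Setoid as SetoidReasoning
open import Relation.Nullary using (Dec; yes; no; isYes; contradiction)
  renaming (¬_ to Not)
open import Relation.Nullary.Decidable using (toWitness; fromWitness)

private
  variable
    ℓ : Level

-- Diaconescu: a choice function on Bool / (true ~ false iff P) decides P.

choice⇒excludedMiddle : AxiomOfChoice ℓ → ExcludedMiddle ℓ
choice⇒excludedMiddle {ℓ} ac {P} = decide
  where
  _~_ : Bool → Bool → Set ℓ
  x ~ y = x ≡ y ⊎ P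

  ~-sym : ∀ {x y} → x ~ y → y ~ x
  ~-sym (inj₁ p) = inj₁ (≡.sym p)
  ~-sym (inj₂ p) = inj₂ p

  ~-trans : ∀ {x y z} → x ~ y → y ~ z → x ~ z
  ~-trans (inj₁ ≡.refl) q = q
  ~-trans (inj₂ p)      _ = inj₂ p

  X Y : Setoid ℓ ℓ
  X = record
    { Carrier       = Lift ℓ Bool
    ; _≈_           = λ x y → lower x ~ lower y
    ; isEquivalence = record { refl = inj₁ ≡.refl ; sym = ~-sym ; trans = ~-trans }
    }
  Y = ≡.setoid (Lift ℓ Bool)

  choose : Σ[ f ∈ Func X Y ] (∀ x → lower x ~ lower (Func.to f x))
  choose = ac X Y (λ x y → lower x ~ lower y)
    (λ { x~x′ ≡.refl x~y → ~-trans (~-sym x~x′) x~y })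
    (λ x → x , inj₁ ≡.refl)

  open Func (proj₁ choose) using (to; cong)

  decide : Dec P
  decide with proj₂ choose (lift true) | proj₂ choose (lift false)
  ... | inj₂ r | _      = yes r
  ... | _      | inj₂ r = yes r
  ... | inj₁ r | inj₁ s = no λ x →
    case ≡.trans r (≡.trans (≡.cong lower (cong (inj₂ x))) (≡.sym s)) of λ ()

-- Transfinite iteration of an inflationary map on subsets.

Subset : Set ℓ → Set ℓ
Subset A = A → Bool

infix 4 _⊆_ _≐_
_⊆_ _≐_ : {A : Set ℓ} → Subset A → Subset A → Set ℓ
S ⊆ S′ = ∀ x → T (S x) → T (S′ x)
S ≐ S′ = S ⊆ S′ × S′ ⊆ S

subsets : Set ℓ → Setoid ℓ ℓ
subsets A = record
  { Carrier       = Subset A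
  ; _≈_           = _≐_
  ; isEquivalence = record
    { refl  = (λ _ → id) , (λ _ → id)
    ; sym   = λ (p , q) → q , p
    ; trans = λ (p , q) (p′ , q′) → (λ x → p′ x ∘ p x) , (λ x → q x ∘ q′ x)
    }
  }

T-⇔→≡ : ∀ {b c} → (T b → T c) → (T c → T b) → b ≡ c
T-⇔→≡ f g = ⇔→≡ (mk⇔ (to T-≡ ∘ f ∘ from T-≡) (to T-≡ ∘ g ∘ from T-≡))
  where open Equivalence

module TransfiniteIteration
  {ℓ : Level} (em : ExcludedMiddle ℓ) {A : Set ℓ} (S₀ : Subset A)
  (g : Subset A → Subset A) (g-inflationary : ∀ S → S ⊆ g S)
  (g-resp : ∀ {S S′} → S ≐ S′ → g S ⊆ g S′)
  where

  ⋃ : Subset (Subset A) → Subset A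
  ⋃ C x = isYes (em {∃ λ S → T (C S) × T (S x)})

  ∈⋃⁺ : ∀ C {S x} → T (C S) → T (S x) → T (⋃ C x)
  ∈⋃⁺ C {S} S∈C x∈S = fromWitness (S , S∈C , x∈S)

  ∈⋃⁻ : ∀ C x → T (⋃ C x) → ∃ λ S → T (C S) × T (S x)
  ∈⋃⁻ C x = toWitness

  -- The Bourbaki-Witt tower over `S₀`, which replaces recursion on ordinals. Unions range over
  -- inhabited families, so that every stage contains `S₀`.
  data Stage : Subset A → Set ℓ where
    start : Stage S₀
    step  : ∀ {S} → Stage S → Stage (g S)
    union : ∀ C → (∃ λ S → T (C S)) → (∀ S → T (C S) → Stage S) → Stage (⋃ C)

  start⊆ : ∀ {S} → Stage S → S₀ ⊆ S
  start⊆ start                   = λ _ → id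
  start⊆ (step {S} s)            = λ x → g-inflationary S x ∘ start⊆ s x
  start⊆ (union C (S , S∈C) all) = λ x → ∈⋃⁺ C S∈C ∘ start⊆ (all S S∈C) x

  -- For a successor, `S` and `S′` are compared both ways: opposite inclusions give `S ≐ S′`, and
  -- `g-resp` applies. For a union, excluded middle asks whether some member already contains
  -- `g S′`.
  compare : ∀ {S S′} → Stage S → Stage S′ → S ⊆ S′ ⊎ g S′ ⊆ S
  compare start s′ = inj₁ (start⊆ s′)
  compare (step {S} s) s′ with compare s s′ | compare s′ s
  ... | inj₂ gS′⊆S | _          = inj₂ λ x → g-inflationary S x ∘ gS′⊆S x
  ... | inj₁ _     | inj₂ gS⊆S′ = inj₁ gS⊆S′
  ... | inj₁ S⊆S′  | inj₁ S′⊆S  = inj₂ (g-resp (S′⊆S , S⊆S′))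
  compare {S′ = S′} (union C _ all) s′ with em {∃ λ S → T (C S) × (g S′ ⊆ S)}
  ... | yes (S , S∈C , gS′⊆S) = inj₂ λ x → ∈⋃⁺ C S∈C ∘ gS′⊆S x
  ... | no none = inj₁ λ x x∈⋃ → let S , S∈C , x∈S = ∈⋃⁻ C x x∈⋃ in
    case compare (all S S∈C) s′ of λ
      { (inj₁ S⊆S′)  → S⊆S′ x x∈S
      ; (inj₂ gS′⊆S) → contradiction (S , S∈C , gS′⊆S) none
      }

  linear : ∀ {S S′} → Stage S → Stage S′ → S ⊆ S′ ⊎ S′ ⊆ S
  linear {S′ = S′} s s′ =
    map₂ (λ gS′⊆S x → gS′⊆S x ∘ g-inflationary S′ x) (compare s s′)

  -- Excluded middle makes the collection of all stages Bool-valued, so `union` applies to it and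
  -- `limit` is itself a stage.
  stages : Subset (Subset A)
  stages S = isYes (em {Stage S})

  limit : Subset A
  limit = ⋃ stages

  limit-stage : Stage limit
  limit-stage = union stages (S₀ , fromWitness start) (λ _ → toWitness)

  limit-closed : g limit ⊆ limit
  -- Since `limit` is a stage, `g limit` is one of the sets in the union.
  limit-closed _ = ∈⋃⁺ stages (fromWitness (step limit-stage))

-- Proper filters and two-valued characters of a Boolean algebra.

module _ {ℓ : Level} (𝓐 : BooleanAlgebra ℓ ℓ) where
  open BooleanAlgebra 𝓐
  open BooleanAlgebraProperties 𝓐

  record IsProperFilter (S : Subset Carrier) : Set ℓ where
    field
      resp     : ∀ {x y} → x ≈ y → T (S x) → T (S y)
      ⊤-mem    : T (S ⊤)
      ∨-closed : ∀ {x} y → T (S x) → T (S (x ∨ y))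
      ∧-closed : ∀ {x y} → T (S x) → T (S y) → T (S (x ∧ y))
      proper   : Not (T (S ⊥))

    ∧-projˡ : ∀ {x y} → T (S (x ∧ y)) → T (S x)
    ∧-projˡ p = resp (trans (∨-comm _ _) (∨-absorbs-∧ _ _)) (∨-closed _ p)

    ∧-projʳ : ∀ {x y} → T (S (x ∧ y)) → T (S y)
    ∧-projʳ p = ∧-projˡ (resp (∧-comm _ _) p)

    consistent : ∀ {x} → T (S (¬ x)) → Not (T (S x))
    consistent p q = proper (resp (∧-complementˡ _) (∧-closed p q))

  Undecided : Subset Carrier → Carrier → Set
  Undecided S a = Not (T (S a)) × Not (T (S (¬ a)))

  -- A Boolean homomorphism into `𝔸₂`. The laws for `∧` and `¬` suffice: De Morgan yields `∨`, and
  -- `⊤ ∨ ¬ ⊤` yields `⊤`.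
  record Character : Set ℓ where
    field
      χ      : Carrier → Bool
      χ-cong : ∀ {x y} → x ≈ y → χ x ≡ χ y
      ∧-homo : ∀ x y → χ (x ∧ y) ≡ χ x Bool.∧ χ y
      ¬-homo : ∀ x → χ (¬ x) ≡ Bool.not (χ x)

    ∨-homo : ∀ x y → χ (x ∨ y) ≡ χ x Bool.∨ χ y
    ∨-homo x y = begin
      χ (x ∨ y)                             ≡⟨ χ-cong (¬-involutive (x ∨ y)) ⟨
      χ (¬ ¬ (x ∨ y))                       ≡⟨ ¬-homo _ ⟩
      Bool.not (χ (¬ (x ∨ y)))              ≡⟨ ≡.cong Bool.not (χ-cong (deMorgan₂ x y)) ⟩
      Bool.not (χ (¬ x ∧ ¬ y))              ≡⟨ ≡.cong Bool.not (∧-homo _ _) ⟩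
      Bool.not (χ (¬ x) Bool.∧ χ (¬ y))
        ≡⟨ ≡.cong₂ (λ b c → Bool.not (b Bool.∧ c)) (¬-homo x) (¬-homo y) ⟩
      Bool.not (Bool.not (χ x) Bool.∧ Bool.not (χ y))
        ≡⟨ 𝔹.¬-cong (𝔹.deMorgan₂ (χ x) (χ y)) ⟨
      Bool.not (Bool.not (χ x Bool.∨ χ y))  ≡⟨ 𝔹.¬-involutive _ ⟩
      χ x Bool.∨ χ y                        ∎
      where
      open ≡.≡-Reasoning
      module 𝔹 where
        open BooleanAlgebra 𝔸₂ public using (¬-cong)
        open BooleanAlgebraProperties 𝔸₂ public using (deMorgan₂; ¬-involutive)

    ⊤-homo : χ ⊤ ≡ true
    ⊤-homo =
      ≡.trans (χ-cong (sym (∨-complementʳ ⊤)))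
        (≡.trans (∨-homo _ _)
          (≡.trans (≡.cong (χ ⊤ Bool.∨_) (¬-homo ⊤)) (Bool.∨-inverseʳ (χ ⊤))))

  -- The characteristic function of `U` is the character. For negation, properness excludes that `x`
  -- and `¬ x` both belong to `U`, and the second hypothesis that neither does.
  ultrafilter⇒character : ∀ {U} → IsProperFilter U → (∀ a → Not (Undecided U a)) →
                          Character
  ultrafilter⇒character {U} filter ultra = record
    { χ      = U
    ; χ-cong = λ x≈y → T-⇔→≡ (resp x≈y) (resp (sym x≈y))
    ; ∧-homo = λ x y → T-⇔→≡
        (λ p → from Bool.T-∧ (∧-projˡ p , ∧-projʳ p))
        (λ p → let q , r = to Bool.T-∧ p in ∧-closed q r)
    ; ¬-homo = ¬-homo
    }
    where
    open IsProperFilter filter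
    open Equivalence

    ¬-homo : ∀ x → U (¬ x) ≡ Bool.not (U x)
    ¬-homo x with U x | U (¬ x) | consistent {x} | ultra x
    ... | true  | true  | c | _ = ⊥-elim (c tt tt)
    ... | true  | false | _ | _ = ≡.refl
    ... | false | true  | _ | _ = ≡.refl
    ... | false | false | _ | u = ⊥-elim (u (id , id))

  -- Ultrafilters from choice, and separation of points.

  module _ (ac : AxiomOfChoice ℓ) where
    private
      abstract
        em : ExcludedMiddle ℓ
        em = choice⇒excludedMiddle ac

      -- The default `⊤` makes the relation total; adjoining it leaves a filter unchanged, since
      -- `¬ ⊤ ∨ x ≈ x`.
      Choice : Subset Carrier → Carrier → Set ℓ
      Choice S a = Undecided S a ⊎ (Not (∃ (Undecided S)) × a ≡ ⊤)

      Undecided-resp : ∀ {S S′ a} → S ≐ S′ → Undecided S a → Undecided S′ a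
      Undecided-resp (_ , S′⊆S) (p , q) = (p ∘ S′⊆S _) , (q ∘ S′⊆S _)

      -- With `≡` on the target, equal subsets get identical picks, so `extend` respects `≐` even on
      -- subsets not closed under `≈`.
      choose : Σ[ f ∈ Func (subsets Carrier) (≡.setoid Carrier) ]
                 (∀ S → Choice S (Func.to f S))
      choose = ac (subsets Carrier) (≡.setoid Carrier) Choice
        (λ { e ≡.refl (inj₁ u) → inj₁ (Undecided-resp e u)
           ; (p , q) ≡.refl (inj₂ (none , a≡⊤)) →
               inj₂ ((λ (a , u) → none (a , Undecided-resp (q , p) u)) , a≡⊤) })
        (λ S → case em {∃ (Undecided S)} of λ
           { (yes (a , u)) → a , inj₁ u
           ; (no none)     → ⊤ , inj₂ (none , ≡.refl) })

      pick : Subset Carrier → Carrier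
      pick = Func.to (proj₁ choose)

      -- For a filter S the second disjunct alone defines the enlargement; the
      -- first makes it inflationary on arbitrary subsets.
      extend : Subset Carrier → Subset Carrier
      extend S x = S x Bool.∨ S (¬ pick S ∨ x)

      extend-inflationary : ∀ S → S ⊆ extend S
      extend-inflationary S x = Equivalence.from T-∨ ∘ inj₁

      extend-resp : ∀ {S S′} → S ≐ S′ → extend S ⊆ extend S′
      extend-resp {S} {S′} e@(S⊆S′ , _) x p = from T-∨ (case to T-∨ p of λ
        { (inj₁ q) → inj₁ (S⊆S′ _ q)
        ; (inj₂ q) → inj₂ (≡.subst (λ a → T (S′ (¬ a ∨ x)))
                             (Func.cong (proj₁ choose) e) (S⊆S′ _ q)) })
        where open Equivalence

      extend-filter : ∀ {S} → IsProperFilter S → IsProperFilter (extend S)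
      extend-filter {S} filter = record
        { resp     = λ x≈y → ⇒mem ∘ resp (∨-congˡ x≈y) ∘ mem⇒
        ; ⊤-mem    = ⇒mem (resp (sym (∨-zeroʳ _)) ⊤-mem)
        ; ∨-closed = λ y → ⇒mem ∘ resp (∨-assoc _ _ _) ∘ ∨-closed y ∘ mem⇒
        ; ∧-closed = λ p q →
            ⇒mem (resp (sym (∨-distribˡ-∧ _ _ _)) (∧-closed (mem⇒ p) (mem⇒ q)))
        -- Membership of `⊥` would put `¬ pick S` in `S`; but the pick is undecided, or it is `⊤`
        -- and `S` is proper.
        ; proper   = λ p → ¬pick∉ (proj₂ choose S) (resp (∨-identityʳ _) (mem⇒ p))
        }
        where
        open IsProperFilter filter
        open Equivalence

        mem⇒ : ∀ {x} → T (extend S x) → T (S (¬ pick S ∨ x))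
        mem⇒ p = [ resp (∨-comm _ _) ∘ ∨-closed _ , id ] (to T-∨ p)

        ⇒mem : ∀ {x} → T (S (¬ pick S ∨ x)) → T (extend S x)
        ⇒mem = from T-∨ ∘ inj₂

        ¬pick∉ : ∀ {a} → Choice S a → Not (T (S (¬ a)))
        ¬pick∉ (inj₁ (_ , q))      = q
        ¬pick∉ (inj₂ (_ , ≡.refl)) = proper ∘ resp ¬⊤≈⊥

      -- An undecided pick would enter `extend S`, because `¬ a ∨ a ≈ ⊤`, and hence lie in `S`.
      closed⇒ultra : ∀ {S} → IsProperFilter S → extend S ⊆ S → ∀ a → Not (Undecided S a)
      closed⇒ultra {S} filter closed a u with proj₂ choose S
      ... | inj₂ (none , _)  = none (a , u)
      ... | inj₁ (pick∉ , _) = pick∉ (closed _ (Equivalence.from T-∨ (inj₂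
        (resp (sym (∨-complementˡ _)) ⊤-mem))))
        where open IsProperFilter filter

      -- The principal filter of `b`, with the order expressed by meets.
      ↑ : Carrier → Subset Carrier
      ↑ b x = isYes (em {b ∧ x ≈ b})

      ↑-filter : ∀ {b} → Not (b ≈ ⊥) → IsProperFilter (↑ b)
      ↑-filter {b} b≉⊥ = record
        { resp     = λ x≈y p → fromWitness (trans (∧-congˡ (sym x≈y)) (toWitness p))
        ; ⊤-mem    = fromWitness (∧-identityʳ b)
        ; ∨-closed = λ {x} y p → fromWitness (begin
            b ∧ (x ∨ y)      ≈⟨ ∧-distribˡ-∨ b x y ⟩
            b ∧ x ∨ b ∧ y    ≈⟨ ∨-congʳ (toWitness p) ⟩
            b ∨ b ∧ y        ≈⟨ ∨-absorbs-∧ b y ⟩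
            b                ∎)
        ; ∧-closed = λ {x} {y} p q → fromWitness (begin
            b ∧ (x ∧ y)      ≈⟨ ∧-assoc b x y ⟨
            (b ∧ x) ∧ y      ≈⟨ ∧-congʳ (toWitness p) ⟩
            b ∧ y            ≈⟨ toWitness q ⟩
            b                ∎)
        ; proper   = λ p → b≉⊥ (trans (sym (toWitness p)) (∧-zeroʳ b))
        }
        where open SetoidReasoning setoid

    character-through : ∀ {b} → Not (b ≈ ⊥) → Σ[ c ∈ Character ] T (Character.χ c b)
    character-through {b} b≉⊥ =
      ultrafilter⇒character limit-filter (closed⇒ultra limit-filter limit-closed) ,
      start⊆ limit-stage b (fromWitness (∧-idem b))
      where
      open TransfiniteIteration em (↑ b) extend extend-inflationary extend-resp

      stage-filter : ∀ {S} → Stage S → IsProperFilter S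
      stage-filter start    = ↑-filter b≉⊥
      stage-filter (step s) = extend-filter (stage-filter s)
      stage-filter (union C (S₁ , S₁∈C) all) = record
        { resp     = λ {x} x≈y p → let S , S∈C , q = ∈⋃⁻ C x p in
            ∈⋃⁺ C S∈C (F.resp S S∈C x≈y q)
        ; ⊤-mem    = ∈⋃⁺ C S₁∈C (F.⊤-mem S₁ S₁∈C)
        ; ∨-closed = λ {x} y p → let S , S∈C , q = ∈⋃⁻ C x p in
            ∈⋃⁺ C S∈C (F.∨-closed S S∈C y q)
        ; ∧-closed = λ {x} {y} p p′ →
            let S  , S∈C  , q  = ∈⋃⁻ C x p
                S′ , S′∈C , q′ = ∈⋃⁻ C y p′
            -- Both elements lie in the larger of the two stages.
            in case linear (all S S∈C) (all S′ S′∈C) of λ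
              { (inj₁ S⊆S′) → ∈⋃⁺ C S′∈C (F.∧-closed S′ S′∈C (S⊆S′ x q) q′)
              ; (inj₂ S′⊆S) → ∈⋃⁺ C S∈C (F.∧-closed S S∈C q (S′⊆S y q′)) }
        ; proper   = λ p → let S , S∈C , q = ∈⋃⁻ C ⊥ p in F.proper S S∈C q
        }
        where
        module F S (S∈C : T (C S)) = IsProperFilter (stage-filter (all S S∈C))

      limit-filter : IsProperFilter limit
      limit-filter = stage-filter limit-stage

    -- Otherwise `¬ x` is nonzero, and some character sends it to `true`, hence `x` to `false`.
    characters-detect-⊤ : ∀ {x} → (∀ c → Character.χ c x ≡ true) → x ≈ ⊤
    characters-detect-⊤ {x} χx≡true with em {¬ x ≈ ⊥}
    ... | yes ¬x≈⊥ = trans (sym (¬-involutive x)) (trans (¬-cong ¬x≈⊥) ¬⊥≈⊤)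
    ... | no  ¬x≉⊥ with c , p ← character-through ¬x≉⊥ =
      ⊥-elim (≡.subst T (≡.trans (¬-homo x) (≡.cong Bool.not (χx≡true c))) p)
      where open Character c

    characters-separate : ∀ {x y} → (∀ c → Character.χ c x ≡ Character.χ c y) → x ≈ y
    characters-separate {x} {y} χx≡χy = begin
      x      ≈⟨ below χx≡χy ⟨
      x ∧ y  ≈⟨ ∧-comm x y ⟩
      y ∧ x  ≈⟨ below (λ c → ≡.sym (χx≡χy c)) ⟩
      y      ∎
      where
      open SetoidReasoning setoid

      -- Every character sends `¬ x ∨ y` to `true`, so this element is `⊤`.
      below : ∀ {x y} → (∀ c → Character.χ c x ≡ Character.χ c y) → x ∧ y ≈ x
      below {x} {y} χx≡χy = begin
        x ∧ y              ≈⟨ ∨-identityˡ _ ⟨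
        ⊥ ∨ x ∧ y          ≈⟨ ∨-congʳ (∧-complementʳ x) ⟨
        x ∧ ¬ x ∨ x ∧ y    ≈⟨ ∧-distribˡ-∨ x (¬ x) y ⟨
        x ∧ (¬ x ∨ y)      ≈⟨ ∧-congˡ (characters-detect-⊤ λ c → let open Character c in
                                ≡.trans (∨-homo (¬ x) y)
                                  (≡.trans (≡.cong₂ Bool._∨_ (¬-homo x) (≡.sym (χx≡χy c)))
                                    (Bool.∨-inverseˡ (χ x)))) ⟩
        x ∧ ⊤              ≈⟨ ∧-identityʳ x ⟩
        x                  ∎

-- The embedding of a swap structure.

theorem8p21 : ∀ {ℓ} → AxiomOfChoice ℓ →
    (𝓐 : BooleanAlgebra ℓ ℓ) (𝓑 : SwapStructure 𝓐) →
    Σ[ I ∈ Set ℓ ]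
    Σ[ h ∈ Hom (SwapStructure.multialgebra 𝓑) (∏ I (λ _ → SwapStructure.multialgebra (fullSwap 𝔸₂))) ]
    IsMonomorphism h
theorem8p21 ac 𝓐 𝓑 = Character 𝓐 , ĥ ,
  λ _ g h ĥg≈ĥh x → injective (Hom.to g x) (Hom.to h x) (ĥg≈ĥh x)
  where
  open BooleanAlgebra 𝓐
  open Snapshots 𝓐
  module B = SwapStructure 𝓑
  module S₂ = SwapStructure (fullSwap 𝔸₂)
  module 𝔸₂-Snapshots = Snapshots 𝔸₂
  open Character

  image : Character 𝓐 → B.B → S₂.B
  image c (z , z∈B) =
    (χ c (z ₁) , χ c (z ₂) , χ c (z ₃)) ,
    ≡.trans (≡.sym (∨-homo c _ _)) (≡.trans (χ-cong c z₁∨z₂≈⊤) (⊤-homo c)) ,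
    ≡.trans (χ-cong c z₃≈) (≡.trans (¬-homo c _) (≡.cong Bool.not (∧-homo c _ _)))
    where
    z₁∨z₂≈⊤ = proj₁ (B.Dom⊆Bciw z∈B)
    z₃≈     = proj₂ (B.Dom⊆Bciw z∈B)

  -- Apart from `∘′`, the full structure over `𝔸₂` constrains only the first coordinate of a value,
  -- so the inclusions (i) and (ii) are enough.
  image-hom : ∀ c {n} (s : Symbol n) {as u} → B.op s as u →
              S₂.op s (map (image c) as) (image c u)
  image-hom c ∧′ {z ∷ w ∷ []} {u} p = ≡.trans (χ-cong c (B.∧-swap z w u p)) (∧-homo c _ _)
  image-hom c ∨′ {z ∷ w ∷ []} {u} p = ≡.trans (χ-cong c (B.∨-swap z w u p)) (∨-homo c _ _)
  image-hom c →′ {z ∷ w ∷ []} {u} p = ≡.trans (χ-cong c (B.→-swap z w u p))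
    (≡.trans (∨-homo c _ _) (≡.cong (Bool._∨ _) (¬-homo c _)))
  image-hom c ¬′ {z ∷ []} {u} p = χ-cong c (B.¬-swap z u p)
  image-hom c ∘′ {z ∷ []} {u} p with q₁ , q₂ , q₃ ← Equivalence.to (B.∘-swap z u) p =
    ≡.trans (χ-cong c q₁) (≡.trans (¬-homo c _) (≡.cong Bool.not (∧-homo c _ _))) ,
    ≡.trans (χ-cong c q₂) (∧-homo c _ _) ,
    ≡.trans (χ-cong c q₃) (⊤-homo c)

  ĥ : Hom B.multialgebra (∏ (Character 𝓐) (λ _ → S₂.multialgebra))
  ĥ = record
    { to   = λ z c → image c z
    ; cong = λ (p , q , r) c → χ-cong c p , χ-cong c q , χ-cong c r
    -- Exposing the argument vectors lets the nested `map`s compute to `map (image c)`.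
    ; hom  = λ { ∧′ {_ ∷ _ ∷ []} p c → image-hom c ∧′ p
               ; ∨′ {_ ∷ _ ∷ []} p c → image-hom c ∨′ p
               ; →′ {_ ∷ _ ∷ []} p c → image-hom c →′ p
               ; ¬′ {_ ∷ []} p c → image-hom c ¬′ p
               ; ∘′ {_ ∷ []} p c → image-hom c ∘′ p }
    }

  injective : ∀ z w → (∀ c → proj₁ (image c z) 𝔸₂-Snapshots.≈₃ proj₁ (image c w)) → proj₁ z ≈₃ proj₁ w
  injective (z , z∈B) (w , w∈B) e =
    z₁≈w₁ , z₂≈w₂ ,
    -- The third coordinate is a function of the first two.
    trans (proj₂ (B.Dom⊆Bciw z∈B))
      (trans (¬-cong (∧-cong z₁≈w₁ z₂≈w₂)) (sym (proj₂ (B.Dom⊆Bciw w∈B))))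
    where
    z₁≈w₁ = characters-separate 𝓐 ac (λ c → proj₁ (e c))
    z₂≈w₂ = characters-separate 𝓐 ac (λ c → proj₁ (proj₂ (e c)))
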